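{- For all integers $l\geq 2$ and $N>0$ there exists an odd $l$-meager hypergraph with more than $N$ vertices.
   Context: A hypergraph is a pair $H=(U,T)$ where $U$ is a finite nonempty set of vertices and $T$ is a collection of 3-element subsets of $U$, called hyperedges. For a nonempty $X\subseteq U$, $\|X\|$ denotes its cardinality and its weight $[X]$ is the number of hyperedges $h\in T$ with $h\subseteq X$. A vertex set $X$ is dense if $\|X\|\leq 2[X]$. $H$ is $l$-meager if it has no dense vertex sets of cardinality $\leq 2l$. $H$ is odd if for every nonempty vertex set $X$ there is a hyperedge $h$ with $\|h\cap X\|$ odd. -}

module Defs where

open import Data.Nat using (ℕ; _≤_; _*_; _%_)
open import Data.Fin.Subset using (Subset; ∣_∣; _⊆_; _∩_; Nonempty)
open import Data.Fin.Subset.Properties using (_⊆?_)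
open import Data.List using (List; length; filter)
open import Data.List.Relation.Unary.All using (All)
open import Data.List.Relation.Unary.Any using (Any)
open import Data.List.Relation.Unary.Unique.Propositional using (Unique)
open import Data.Product using (_×_)
open import Relation.Nullary using (¬_)
open import Relation.Binary.PropositionalEquality using (_≡_)

record Hypergraph : Set where
  field
    n        : ℕ
    nonempty : 1 ≤ n
    edges    : List (Subset n)
    edges-3  : All (λ h → ∣ h ∣ ≡ 3) edges
    edges-uq : Unique edges
open Hypergraph public

numVertices : Hypergraph → ℕ
numVertices H = n H

weight : (H : Hypergraph) → Subset (n H) → ℕ
weight H X = length (filter (λ h → h ⊆? X) (edges H))

Dense : (H : Hypergraph) → Subset (n H) → Set
Dense H X = ∣ X ∣ ≤ 2 * weight H X

Meager : ℕ → Hypergraph → Set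
Meager l H = (X : Subset (n H)) → Nonempty X → ∣ X ∣ ≤ 2 * l → ¬ Dense H X

Odd : Hypergraph → Set
Odd H = (X : Subset (n H)) → Nonempty X → Any (λ h → ∣ h ∩ X ∣ % 2 ≡ 1) (edges H)

-- A hypergraph is l-meager when it has no Berge cycle of length at most l, and odd when
-- its incidence matrix is injective over 𝔽₂.  Start from a single vertex v with the
-- degenerate edge {v,v,v}, which is odd since 3 is, and pass repeatedly to the ℤ/2-homology
-- cover of the incidence graph: V × 𝔽₂^D over V, with one coordinate for every incidence
-- in D, which is flipped when that incidence is crossed.  The cover is a tower of 2-lifts, and
-- these preserve oddness.  A closed walk in the cover projects to a closed walk crossing
-- every incidence an even number of times; the part between two crossings of the same
-- incidence yields a shorter closed walk, so the girth grows strictly.  Finally,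
-- a vertex set below the girth is not dense: peel off edges two of whose points are in
-- no other edge; if there is none, a non-backtracking walk can go on until it closes up.

module Submission where

open import Defs
open import Data.Nat using (ℕ; zero; suc; _+_; _*_; _^_; _%_; _≤_; _<_; z≤n; s≤s; s≤s⁻¹; >-nonZero)
open import Data.Nat.Properties as ℕ using (module ≤-Reasoning)
open import Data.Product using (Σ; ∃; _×_; _,_; proj₁; proj₂; uncurry)
open import Data.Product.Properties using (,-injectiveˡ; ,-injectiveʳ)
open import Data.Product.Function.NonDependent.Propositional using (_×-↔_)
open import Data.Sum using (_⊎_; inj₁; inj₂)
open import Data.Bool using (Bool; true; false; not; _xor_; if_then_else_)
import Data.Bool.Properties as Bool
open import Data.Fin using (Fin; zero; suc; combine)
import Data.Fin.Properties as Fin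
open import Data.Fin.Subset as Subset using (Subset; inside; outside; ∣_∣; _∩_; _∪_; Nonempty; _-_; ⁅_⁆)
import Data.Fin.Subset.Properties as Subset
open import Data.Vec as Vec using (Vec; []; _∷_; lookup; tabulate; zipWith; head; tail)
import Data.Vec.Properties as Vec
open import Data.List using (List; []; _∷_; length; filter; map; allFin)
import Data.List.Properties as List
open import Data.List.Relation.Unary.All as All using ([]; _∷_)
import Data.List.Relation.Unary.All.Properties as All
open import Data.List.Relation.Unary.Any as Any using (Any; here)
open import Data.List.Relation.Unary.AllPairs using ([]; _∷_)
open import Data.List.Relation.Unary.Unique.Propositional using (Unique)
import Data.List.Relation.Unary.Unique.Propositional.Properties as Unique
open import Data.List.Membership.Propositional using (_∈_; find; lose)
import Data.List.Membership.Propositional.Properties as ∈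
open import Algebra.Bundles using (CommutativeRing)
open import Algebra.Properties.CommutativeSemigroup
  (CommutativeRing.+-commutativeSemigroup Bool.xor-∧-commutativeRing)
  using () renaming (interchange to xor-interchange)
open import Function using (_∘_; _↔_; Inverse; Injection; mk↔ₛ′)
open import Function.Properties.Inverse using (↔-refl; ↔-sym; ↔-trans; ↔⇒↣)
open import Relation.Nullary using (¬_; Dec; yes; no; does; contradiction; ¬?)
open import Relation.Nullary.Decidable using (_×-dec_; dec-true; dec-false)
open import Relation.Binary.Definitions using (DecidableEquality)
open import Relation.Binary.PropositionalEquality
  using (_≡_; _≢_; refl; sym; trans; cong; cong₂; subst; module ≡-Reasoning)

-- Non-backtracking walks and girth

module Walks {V E : Set} (inc : E → Fin 3 → V) where

  Dart : Set
  Dart = E × Fin 3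

  at : Dart → V
  at (e , j) = inc e j

  -- Path d v n is a non-backtracking walk with n steps from at d to v whose first
  -- step may not enter the edge through d; a step enters e at slot i and leaves
  -- it at slot j.
  data Path : Dart → V → ℕ → Set where
    stop : ∀ {d v} → at d ≡ v → Path d v 0
    step : ∀ {d v n} e i j → at d ≡ inc e i → d ≢ (e , i) → i ≢ j →
           Path (e , j) v n → Path d v (suc n)

  -- A closed non-backtracking walk with suc n steps, cut before its first step.
  Closed : ℕ → Set
  Closed n = ∃ λ e → ∃ λ i → ∃ λ j → i ≢ j × Path (e , j) (inc e i) n

  -- Since `Closed n` has `suc n` steps, the excluded walks are those of at most `g` steps.
  Girth> : ℕ → Set
  Girth> g = ∀ {n} → n < g → ¬ Closed n

  -- A path from d that returns to the dart t before its end, entering (first case)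
  -- or leaving (second case) the edge of t through t.
  Revisits : Dart → Dart → ℕ → Set
  Revisits t d n = ∃ λ m → m < n × (Path d (at t) m ⊎
    (∃ λ k → k ≢ proj₂ t × (m ≡ 0 → d ≢ (proj₁ t , k)) × Path d (inc (proj₁ t) k) m))

  revisits-step : ∀ {t d n} e i j → at d ≡ inc e i → d ≢ (e , i) → i ≢ j →
                  Revisits t (e , j) n → Revisits t d (suc n)
  revisits-step e i j eq nb i≢j (m , m<n , inj₁ p) =
    suc m , s≤s m<n , inj₁ (step e i j eq nb i≢j p)
  revisits-step e i j eq nb i≢j (m , m<n , inj₂ (k , k≢ , _ , p)) =
    suc m , s≤s m<n , inj₂ (k , k≢ , (λ ()) , step e i j eq nb i≢j p)

  -- A path that returns to `at t`, or enters `e` at a slot `k` other than `j`, is closed up by a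
  -- step through `e`. If `k` is `j`, the path is already closed without `e`, and the side condition
  -- in `Revisits` rules out that it has no steps.
  revisits⇒closed : ∀ {e i j n} → i ≢ j → Revisits (e , i) (e , j) n → ∃ λ m → m < n × Closed m
  revisits⇒closed {e} {i} {j} i≢j (m , m<n , inj₁ p) = m , m<n , e , i , j , i≢j , p
  revisits⇒closed {e} {i} {j} i≢j (m , m<n , inj₂ (k , k≢i , nb , p)) with k Fin.≟ j
  ... | no k≢j = m , m<n , e , k , j , k≢j , p
  revisits⇒closed i≢j (.0 , m<n , inj₂ (k , k≢i , nb , stop _)) | yes refl =
    contradiction refl (nb refl)
  revisits⇒closed i≢j (suc m , m<n , inj₂ (k , k≢i , nb , step e' i' j' eq _ i'≢j' p)) | yes refl =
    m , ℕ.<-trans (ℕ.n<1+n m) m<n , e' , i' , j' , i'≢j' , subst (λ v → Path (e' , j') v m) eq p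

-- Sums over an edge and bit vectors modulo 2

sum₃ : (Fin 3 → Bool) → Bool
sum₃ f = f zero xor (f (suc zero) xor f (suc (suc zero)))

sum₃-cong : ∀ {f g} → (∀ j → f j ≡ g j) → sum₃ f ≡ sum₃ g
sum₃-cong f≗g = cong₂ _xor_ (f≗g _) (cong₂ _xor_ (f≗g _) (f≗g _))

sum₃-xor : ∀ f g → sum₃ (λ j → f j xor g j) ≡ sum₃ f xor sum₃ g
sum₃-xor f g = trans (cong ((f zero xor g zero) xor_) (xor-interchange (f _) (g _) (f _) (g _)))
                     (xor-interchange (f zero) (g zero) _ _)

-- Trivial kernel of the incidence matrix over 𝔽₂, where a vertex in several slots of an edge counts
-- with multiplicity.
OddInc : {V E : Set} → (E → Fin 3 → V) → Set
OddInc {V} {E} inc = ∀ (f : V → Bool) → (∀ e → sum₃ (λ j → f (inc e j)) ≡ false) → ∀ v → f v ≡ false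

infixl 6 _⊕_
_⊕_ : ∀ {m} → Vec Bool m → Vec Bool m → Vec Bool m
_⊕_ = zipWith _xor_

xor-cancelʳ : ∀ x {y z} → y xor x ≡ z xor x → y ≡ z
xor-cancelʳ x {y} {z} eq = begin
  y                ≡⟨ unfold y ⟨
  (y xor x) xor x  ≡⟨ cong (_xor x) eq ⟩
  (z xor x) xor x  ≡⟨ unfold z ⟩
  z                ∎
  where
  open ≡-Reasoning
  unfold : ∀ w → (w xor x) xor x ≡ w
  unfold w = trans (Bool.xor-assoc w x x) (trans (cong (w xor_) (Bool.xor-same x)) (Bool.xor-identityʳ w))

⊕-cancelʳ : ∀ {m} (x : Vec Bool m) {y z} → y ⊕ x ≡ z ⊕ x → y ≡ z
⊕-cancelʳ []       {[]}     {[]}     eq = refl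
⊕-cancelʳ (a ∷ x) {b ∷ y} {c ∷ z} eq =
  cong₂ _∷_ (xor-cancelʳ a (cong head eq)) (⊕-cancelʳ x (cong tail eq))

unit : ∀ {m} → Fin m → Vec Bool m
unit i = tabulate (λ k → does (k Fin.≟ i))

lookup-⊕-unit-same : ∀ {m} (w : Vec Bool m) i → lookup (w ⊕ unit i) i ≡ not (lookup w i)
lookup-⊕-unit-same w i = begin
  lookup (w ⊕ unit i) i               ≡⟨ Vec.lookup-zipWith _xor_ i w (unit i) ⟩
  lookup w i xor lookup (unit i) i    ≡⟨ cong (lookup w i xor_) (Vec.lookup∘tabulate _ i) ⟩
  lookup w i xor does (i Fin.≟ i)     ≡⟨ cong (lookup w i xor_) (dec-true (i Fin.≟ i) refl) ⟩
  lookup w i xor true                 ≡⟨ Bool.xor-comm (lookup w i) true ⟩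
  not (lookup w i)                    ∎
  where open ≡-Reasoning

lookup-⊕-unit-other : ∀ {m} (w : Vec Bool m) i k → i ≢ k → lookup (w ⊕ unit i) k ≡ lookup w k
lookup-⊕-unit-other w i k i≢k = begin
  lookup (w ⊕ unit i) k               ≡⟨ Vec.lookup-zipWith _xor_ k w (unit i) ⟩
  lookup w k xor lookup (unit i) k    ≡⟨ cong (lookup w k xor_) (Vec.lookup∘tabulate _ k) ⟩
  lookup w k xor does (k Fin.≟ i)     ≡⟨ cong (lookup w k xor_) (dec-false (k Fin.≟ i) (i≢k ∘ sym)) ⟩
  lookup w k xor false                ≡⟨ Bool.xor-identityʳ _ ⟩
  lookup w k                          ∎
  where open ≡-Reasoning

-- Covers with labels in 𝔽₂^m preserve oddness

-- The derived cover of the incidence graph with voltages `label e j`: each incidence translates the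
-- sheet by its label.
cover : ∀ {V E : Set} {m} → (E → Fin 3 → V) → (E → Fin 3 → Vec Bool m) →
        E × Vec Bool m → Fin 3 → V × Vec Bool m
cover inc label (e , w) j = inc e j , w ⊕ label e j

xor≡false⇒≡ : ∀ x {y} → x xor y ≡ false → x ≡ y
xor≡false⇒≡ false eq = sym eq
xor≡false⇒≡ true {true} eq = refl

⊕-cons : ∀ {m} b (w : Vec Bool m) l → (b ∷ w) ⊕ l ≡ (b xor head l) ∷ (w ⊕ tail l)
⊕-cons b w (a ∷ l) = refl

-- Summing over the first coordinate gives a solution on a smaller cover, hence zero;
-- so f does not depend on that coordinate and is itself a solution there.
cover-odd : ∀ {V E : Set} (inc : E → Fin 3 → V) {m} (label : E → Fin 3 → Vec Bool m) →
            OddInc inc → OddInc (cover inc label)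
cover-odd inc {zero} label odd f eqs (v , []) = odd (λ u → f (u , [])) eqs' v
  where
  []-η : (w : Vec Bool 0) → [] ≡ w
  []-η [] = refl
  eqs' : ∀ e → sum₃ (λ j → f (inc e j , [])) ≡ false
  eqs' e = trans (sum₃-cong λ j → cong (λ w → f (inc e j , w)) ([]-η ([] ⊕ label e j))) (eqs (e , []))
cover-odd {V} {E} inc {suc m} label odd f eqs (v , b ∷ w) = f-zero b (v , w)
  where
  open ≡-Reasoning
  label' : E → Fin 3 → Vec Bool m
  label' e j = tail (label e j)

  f̄ : V × Vec Bool m → Bool
  f̄ (u , x) = f (u , false ∷ x) xor f (u , true ∷ x)

  -- A flip of the first bit only swaps the two summands of `f̄`.
  shift : ∀ u x a → f̄ (u , x) ≡ f (u , (false xor a) ∷ x) xor f (u , (true xor a) ∷ x)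
  shift u x false = refl
  shift u x true  = Bool.xor-comm (f (u , false ∷ x)) _

  f̄-zero : ∀ p → f̄ p ≡ false
  f̄-zero = cover-odd inc label' odd f̄ λ (e , x) → begin
    sum₃ (λ j → f̄ (inc e j , x ⊕ label' e j))
      ≡⟨ sum₃-cong (λ j → trans (shift (inc e j) (x ⊕ label' e j) (head (label e j)))
           (sym (cong₂ (λ y z → f (inc e j , y) xor f (inc e j , z))
             (⊕-cons false x (label e j)) (⊕-cons true x (label e j))))) ⟩
    sum₃ (λ j → f (inc e j , (false ∷ x) ⊕ label e j) xor f (inc e j , (true ∷ x) ⊕ label e j))
      ≡⟨ sum₃-xor (λ j → f (inc e j , (false ∷ x) ⊕ label e j))
                  (λ j → f (inc e j , (true ∷ x) ⊕ label e j)) ⟩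
    sum₃ (λ j → f (inc e j , (false ∷ x) ⊕ label e j)) xor sum₃ (λ j → f (inc e j , (true ∷ x) ⊕ label e j))
      ≡⟨ cong₂ _xor_ (eqs (e , false ∷ x)) (eqs (e , true ∷ x)) ⟩
    false ∎

  independent : ∀ a c u x → f (u , a ∷ x) ≡ f (u , c ∷ x)
  independent false false u x = refl
  independent false true  u x = xor≡false⇒≡ _ (f̄-zero (u , x))
  independent true  false u x = sym (xor≡false⇒≡ _ (f̄-zero (u , x)))
  independent true  true  u x = refl

  f-zero : ∀ b p → f (proj₁ p , b ∷ proj₂ p) ≡ false
  f-zero b = cover-odd inc label' odd (λ (u , x) → f (u , b ∷ x)) λ (e , x) →
    trans (sum₃-cong λ j → trans (independent b _ (inc e j) _) (cong (λ y → f (inc e j , y)) (sym (⊕-cons b x (label e j)))))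
          (eqs (e , b ∷ x))

-- Girth of the homology cover

module HomologyCover {V E : Set} (inc : E → Fin 3 → V) {m : ℕ} (index : E × Fin 3 → Fin m)
  (index-injective : ∀ {d d'} → index d ≡ index d' → d ≡ d') where

  label : E → Fin 3 → Vec Bool m
  label e j = unit (index (e , j))

  open Walks inc
  private module C = Walks (cover inc label)

  -- The projection is locally injective: an incidence has only one lift at a given vertex of the
  -- cover, because translation by its label cancels.
  projects-nb : ∀ {e w j e' w' j'} → cover inc label (e , w) j ≡ cover inc label (e' , w') j' →
                ((e , w) , j) ≢ ((e' , w') , j') → (e , j) ≢ (e' , j')
  projects-nb {e} {w} {j} eq nb refl = nb (cong (λ x → (e , x) , j) (⊕-cancelʳ (label e j) (,-injectiveʳ eq)))

  -- Coordinate `index t` of the sheet changes only when `t` is crossed. A step crosses its entering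
  -- and its leaving incidence, which gives the two cases of `Revisits`.
  revisits-or-keeps : ∀ t {e w j v x n} → C.Path ((e , w) , j) (v , x) n →
    Revisits t (e , j) n ⊎ lookup x (index t) ≡ lookup (w ⊕ label e j) (index t)
  revisits-or-keeps t (C.stop refl) = inj₂ refl
  revisits-or-keeps t {e} {w} {j} (C.step (e' , w') i' j' eq nb i'≢j' p)
    with index (e' , i') Fin.≟ index t | index (e' , j') Fin.≟ index t | revisits-or-keeps t p
  ... | yes i'≡t | _ | _ =
        inj₁ (0 , s≤s z≤n , inj₁ (stop (trans (,-injectiveˡ eq) (cong at (index-injective i'≡t)))))
  ... | no _ | yes j'≡t | _ with refl ← index-injective j'≡t =
        inj₁ (0 , s≤s z≤n , inj₂ (i' , i'≢j' , (λ _ → projects-nb eq nb) , stop (,-injectiveˡ eq)))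
  ... | no _ | no _ | inj₁ r =
        inj₁ (revisits-step e' i' j' (,-injectiveˡ eq) (projects-nb eq nb) i'≢j' r)
  ... | no i'≢t | no j'≢t | inj₂ keeps = inj₂ (trans keeps
        (trans (lookup-⊕-unit-other w' _ _ j'≢t)
        (trans (sym (lookup-⊕-unit-other w' _ _ i'≢t))
        (cong (λ y → lookup y (index t)) (sym (,-injectiveʳ eq))))))

  -- The first step flips the coordinate of `(e , i)`, but the walk ends on the sheet where it
  -- began. So the rest of its projection crosses `(e , i)` again, and the part before that crossing
  -- yields the shorter closed walk.
  closed-projects : ∀ {n} → C.Closed n → ∃ λ k → k < n × Closed k
  closed-projects ((e , w) , i , j , i≢j , p) with revisits-or-keeps (e , i) p
  ... | inj₁ r = revisits⇒closed i≢j r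
  ... | inj₂ keeps = contradiction (begin
      not (lookup w (index (e , i)))          ≡⟨ lookup-⊕-unit-same w _ ⟨
      lookup (w ⊕ label e i) (index (e , i))  ≡⟨ keeps ⟩
      lookup (w ⊕ label e j) (index (e , i))  ≡⟨ lookup-⊕-unit-other w _ _ (i≢j ∘ sym ∘ ,-injectiveʳ ∘ index-injective) ⟩
      lookup w (index (e , i))                ∎)
      (Bool.not-¬ refl ∘ sym)
    where open ≡-Reasoning

  girth-grows : ∀ {g} → Girth> g → C.Girth> (suc g)
  girth-grows girth n<1+g c with closed-projects c
  ... | k , k<n , c' = girth (ℕ.<-≤-trans k<n (s≤s⁻¹ n<1+g)) c'

-- The tower of finite covers

Vec-Bool↔ : ∀ m → Vec Bool m ↔ Fin (2 ^ m)
Vec-Bool↔ zero    = mk↔ₛ′ (λ _ → zero) (λ _ → []) (λ { zero → refl }) (λ { [] → refl })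
Vec-Bool↔ (suc m) =
  ↔-trans (mk↔ₛ′ (λ { (b ∷ w) → b , w }) (uncurry _∷_) (λ _ → refl) (λ { (_ ∷ _) → refl }))
  (↔-trans (↔-sym Fin.2↔Bool ×-↔ Vec-Bool↔ m) (↔-sym Fin.*↔×))

-- An edge may meet a vertex in several slots when g = 0.
record OddGirth (g : ℕ) : Set₁ where
  field
    {V E} : Set
    nv ne : ℕ
    V↔    : V ↔ Fin nv
    E↔    : E ↔ Fin ne
    inc   : E → Fin 3 → V
    odd   : OddInc inc
    girth : Walks.Girth> inc g
    g<nv  : g < nv
    0<ne  : 0 < ne

n<m⇒1+n<m*2^k : ∀ {n m k} → n < m → 0 < k → suc n < m * 2 ^ k
n<m⇒1+n<m*2^k {n} {m} {k} n<m 0<k = begin-strict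
  suc n      ≤⟨ n<m ⟩
  m          <⟨ ℕ.m<m*n m 2 {{>-nonZero (ℕ.≤-<-trans z≤n n<m)}} ℕ.≤-refl ⟩
  m * 2      ≤⟨ ℕ.*-monoʳ-≤ m (ℕ.^-monoʳ-≤ 2 0<k) ⟩
  m * 2 ^ k  ∎
  where open ≤-Reasoning

oddGirth : ∀ g → OddGirth g
oddGirth zero = record
  { nv = 1 ; ne = 1 ; V↔ = ↔-refl ; E↔ = ↔-refl ; inc = λ _ _ → zero {0}
  ; odd = λ { f eqs zero → trans (sym (cancel (f zero))) (eqs zero) }
  ; girth = λ ()
  ; g<nv = s≤s z≤n
  ; 0<ne = s≤s z≤n
  }
  where
  cancel : ∀ b → b xor (b xor b) ≡ b
  cancel false = refl
  cancel true  = refl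
oddGirth (suc g) = record
  { V↔ = ↔-trans (V↔ ×-↔ Vec-Bool↔ m) (↔-sym Fin.*↔×)
  ; E↔ = ↔-trans (E↔ ×-↔ Vec-Bool↔ m) (↔-sym Fin.*↔×)
  ; inc = cover inc label
  ; odd = cover-odd inc label odd
  ; girth = girth-grows girth
  -- There is an edge, so the cover has at least two sheets and the vertex count at least doubles.
  ; g<nv = n<m⇒1+n<m*2^k {k = m} g<nv 0<m
  ; 0<ne = ℕ.*-mono-≤ 0<ne (ℕ.m^n>0 2 m)
  }
  where
  open OddGirth (oddGirth g)
  m = ne * 3

  0<m : 0 < m
  0<m = ℕ.*-mono-≤ 0<ne (s≤s (z≤n {2}))

  index : E × Fin 3 → Fin m
  index (e , j) = combine (Inverse.to E↔ e) j

  index-injective : ∀ {d d'} → index d ≡ index d' → d ≡ d'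
  index-injective eq with e≡ , j≡ ← Fin.combine-injective _ _ _ _ eq =
    cong₂ _,_ (Injection.injective (↔⇒↣ E↔) e≡) j≡

  open HomologyCover inc index index-injective

-- Counting in subsets and lists

bit : Bool → ℕ
bit b = if b then 1 else 0

∣⁅⁆∪p∩q∣ : ∀ {n} (a : Fin n) (p q : Subset n) → a Subset.∉ p →
          ∣ (⁅ a ⁆ ∪ p) ∩ q ∣ ≡ bit (lookup q a) + ∣ p ∩ q ∣
∣⁅⁆∪p∩q∣ zero (inside  ∷ p) q a∉p = contradiction Vec.here a∉p
∣⁅⁆∪p∩q∣ zero (outside ∷ p) (outside ∷ q) a∉p = cong (λ r → ∣ r ∩ q ∣) (Subset.∪-identityˡ p)
∣⁅⁆∪p∩q∣ zero (outside ∷ p) (inside  ∷ q) a∉p = cong (λ r → suc ∣ r ∩ q ∣) (Subset.∪-identityˡ p)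
∣⁅⁆∪p∩q∣ (suc a) (outside ∷ p) (_       ∷ q) a∉p = ∣⁅⁆∪p∩q∣ a p q (a∉p ∘ Vec.there)
∣⁅⁆∪p∩q∣ (suc a) (inside  ∷ p) (outside ∷ q) a∉p = ∣⁅⁆∪p∩q∣ a p q (a∉p ∘ Vec.there)
∣⁅⁆∪p∩q∣ (suc a) (inside  ∷ p) (inside  ∷ q) a∉p =
  trans (cong suc (∣⁅⁆∪p∩q∣ a p q (a∉p ∘ Vec.there))) (sym (ℕ.+-suc (bit (lookup q a)) _))

bits-parity : ∀ a b c → (bit a + (bit b + (bit c + 0))) % 2 ≡ bit (a xor (b xor c))
bits-parity false false false = refl
bits-parity false false true  = refl
bits-parity false true  false = refl
bits-parity false true  true  = refl
bits-parity true  false false = refl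
bits-parity true  false true  = refl
bits-parity true  true  false = refl
bits-parity true  true  true  = refl

third : ∀ (i j : Fin 3) → ∃ λ k → k ≢ i × k ≢ j
third zero             zero             = suc zero , (λ ()) , (λ ())
third zero             (suc zero)       = suc (suc zero) , (λ ()) , (λ ())
third zero             (suc (suc zero)) = suc zero , (λ ()) , (λ ())
third (suc zero)       zero             = suc (suc zero) , (λ ()) , (λ ())
third (suc zero)       (suc zero)       = zero , (λ ()) , (λ ())
third (suc zero)       (suc (suc zero)) = zero , (λ ()) , (λ ())
third (suc (suc zero)) zero             = suc zero , (λ ()) , (λ ())
third (suc (suc zero)) (suc _)          = zero , (λ ()) , (λ ())

length-filter-map : ∀ {A B : Set} {P : B → Set} (P? : ∀ b → Dec (P b)) (f : A → B) xs →
                    length (filter P? (map f xs)) ≡ length (filter (P? ∘ f) xs)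
length-filter-map P? f []       = refl
length-filter-map P? f (x ∷ xs) with does (P? (f x))
... | true  = cong suc (length-filter-map P? f xs)
... | false = length-filter-map P? f xs

length-filter-≢ : ∀ {A : Set} (_≟_ : DecidableEquality A) x {xs} → Unique xs →
                  length xs ≤ suc (length (filter (λ y → ¬? (y ≟ x)) xs))
length-filter-≢ _≟_ x [] = z≤n
length-filter-≢ _≟_ x {y ∷ xs} (y∉xs ∷ u) with y ≟ x
... | no  _    = s≤s (length-filter-≢ _≟_ x u)
... | yes refl = s≤s (ℕ.≤-reflexive (cong length
                   (sym (List.filter-all (λ z → ¬? (z ≟ y)) (All.map (λ y≢z → y≢z ∘ sym) y∉xs)))))

-- Sparsity below the girth

module Realisation {g} (H : OddGirth g) where

  open OddGirth H
  open Walks inc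

  enc : V → Fin nv
  enc = Inverse.to V↔

  enc-injective : ∀ {u v} → enc u ≡ enc v → u ≡ v
  enc-injective = Injection.injective (↔⇒↣ V↔)

  _≟V_ : DecidableEquality V
  u ≟V v with enc u Fin.≟ enc v
  ... | yes eq = yes (enc-injective eq)
  ... | no neq = no (neq ∘ cong enc)

  _≟E_ : DecidableEquality E
  e ≟E e' with Inverse.to E↔ e Fin.≟ Inverse.to E↔ e'
  ... | yes eq = yes (Injection.injective (↔⇒↣ E↔) eq)
  ... | no neq = no (neq ∘ cong (Inverse.to E↔))

  point : E → Fin 3 → Fin nv
  point e j = enc (inc e j)

  Shared : List E → E → Fin 3 → Set
  Shared S e j = Any (λ e' → e' ≢ e × ∃ λ i → inc e' i ≡ inc e j) S

  shared? : ∀ S e j → Dec (Shared S e j)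
  shared? S e j = Any.any? (λ e' → ¬? (e' ≟E e) ×-dec Fin.any? (λ i → inc e' i ≟V inc e j)) S

  Leaf : List E → E → Set
  Leaf S e = ∃ λ j → ∃ λ k → j ≢ k × ¬ Shared S e j × ¬ Shared S e k

  leaf? : ∀ S e → Dec (Leaf S e)
  leaf? S e = Fin.any? λ j → Fin.any? λ k →
    ¬? (j Fin.≟ k) ×-dec ¬? (shared? S e j) ×-dec ¬? (shared? S e k)

  Within : Subset nv → List E → Set
  Within X S = ∀ {e} → e ∈ S → ∀ j → point e j Subset.∈ X

  -- If both slots other than `i` were unshared, they would make `e` a leaf.
  leafless-exit : ∀ {S e} → ¬ Leaf S e → ∀ i → ∃ λ k → k ≢ i × Shared S e k
  leafless-exit {S} {e} ¬leaf i with third i i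
  ... | j , j≢i , _ with third i j
  ... | k , k≢i , k≢j with shared? S e j | shared? S e k
  ... | yes s | _     = j , j≢i , s
  ... | no _  | yes s = k , k≢i , s
  ... | no ¬s | no ¬t = contradiction (j , k , k≢j ∘ sym , ¬s , ¬t) ¬leaf

  -- The walk is grown backwards, Y being the part of X not yet visited.
  leafless-closed : ∀ {S X} → (∀ {e} → e ∈ S → ¬ Leaf S e) → Within X S →
    ∀ k c Y {e j} → e ∈ S → ∣ Y ∣ ≤ k → c + k ≤ ∣ X ∣ →
    (∀ {v} → enc v Subset.∈ X → enc v Subset.∉ Y → ∃ λ m → m < c × Path (e , j) v m) →
    ∃ λ m → m < ∣ X ∣ × Closed m
  leafless-closed leafless within k c Y {e} {j} e∈S ∣Y∣≤k c+k≤∣X∣ visited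
    with leafless-exit (leafless e∈S) j
  ... | i , i≢j , s with find s
  ... | e' , e'∈S , e'≢e , i' , eq with point e i Subset.∈? Y
  -- The point in slot `i` is already visited; a step through `e` from `i` to `j` closes the path
  -- that leads there.
  ... | no  u∉Y = let m , m<c , p = visited (within e∈S i) u∉Y in
        m , ℕ.<-≤-trans m<c (ℕ.m+n≤o⇒m≤o c c+k≤∣X∣) , e , i , j , i≢j , p
  leafless-closed leafless within zero c Y e∈S ∣Y∣≤k c+k≤∣X∣ visited
      | i , i≢j , s | e' , e'∈S , e'≢e , i' , eq | yes u∈Y
      = contradiction (ℕ.<-≤-trans (Subset.x∈p⇒∣p-x∣<∣p∣ u∈Y) ∣Y∣≤k) λ ()
  -- Prepending a step raises the length bound `c` by one while `Y` loses a point, so `c + k` does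
  -- not change.
  leafless-closed {X = X} leafless within (suc k) c Y {e} {j} e∈S ∣Y∣≤k c+k≤∣X∣ visited
      | i , i≢j , s | e' , e'∈S , e'≢e , i' , eq | yes u∈Y
      = leafless-closed leafless within k (suc c) (Y - point e i) e'∈S
          (s≤s⁻¹ (ℕ.<-≤-trans (Subset.x∈p⇒∣p-x∣<∣p∣ u∈Y) ∣Y∣≤k))
          (subst (_≤ ∣ X ∣) (ℕ.+-suc c k) c+k≤∣X∣) visited'
    where
    visited' : ∀ {v} → enc v Subset.∈ X → enc v Subset.∉ Y - point e i →
               ∃ λ m → m < suc c × Path (e' , i') v m
    visited' {v} v∈X v∉Y' with v ≟V inc e i | enc v Subset.∈? Y
    ... | yes v≡u | _       = 0 , s≤s z≤n , stop (trans eq (sym v≡u))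
    ... | no  v≢u | yes v∈Y = contradiction (Subset.x∈p∧x≢y⇒x∈p-y v∈Y (v≢u ∘ enc-injective)) v∉Y'
    ... | no  _   | no  v∉Y = let m , m<c , p = visited v∈X v∉Y in
          suc m , s≤s m<c , step e i j eq (e'≢e ∘ ,-injectiveˡ) i≢j p

  -- A vertex in two slots of `e` gives a closed walk of one step.
  inc-injective : 0 < g → ∀ e {i j} → inc e i ≡ inc e j → i ≡ j
  inc-injective 0<g e {i} {j} eq with i Fin.≟ j
  ... | yes i≡j = i≡j
  ... | no  i≢j = contradiction (e , i , j , i≢j , stop (sym eq)) (girth 0<g)

  point-≢ : 0 < g → ∀ e {i j} → i ≢ j → point e i ≢ point e j
  point-≢ 0<g e i≢j = i≢j ∘ inc-injective 0<g e ∘ enc-injective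

  -- Peeling a leaf removes one edge and two points, so the inequality passes from the smaller pair
  -- to the larger; it is strict because `X` stays nonempty. Without a leaf there is a closed walk
  -- of at most `∣ X ∣` steps. The recursion is on the length bound `n`.
  sparse : 0 < g → ∀ n S X → length S ≤ n → Unique S → Within X S → Nonempty X → ∣ X ∣ ≤ g →
           2 * length S < ∣ X ∣
  sparse 0<g n [] X _ _ _ (x , x∈X) _ = ℕ.≤-<-trans z≤n (Subset.x∈p⇒∣p-x∣<∣p∣ x∈X)
  sparse 0<g (suc n) S@(e₀ ∷ _) X ∣S∣≤n u within _ ∣X∣≤g with Any.any? (leaf? S) S
  ... | no ¬any = contradiction closed (girth (ℕ.<-≤-trans m<∣X∣ ∣X∣≤g))
    where
    x₀ = point e₀ zero

    visited₀ : ∀ {v} → enc v Subset.∈ X → enc v Subset.∉ X - x₀ → ∃ λ m → m < 1 × Path (e₀ , zero) v m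
    visited₀ {v} v∈X v∉ with inc e₀ zero ≟V v
    ... | yes eq = 0 , s≤s z≤n , stop eq
    ... | no neq = contradiction (Subset.x∈p∧x≢y⇒x∈p-y v∈X (neq ∘ sym ∘ enc-injective)) v∉

    -- At the start only `x₀` is visited, by the path with no steps, hence `c` is 1.
    walk : ∃ λ m → m < ∣ X ∣ × Closed m
    walk = leafless-closed (λ e∈S leaf → ¬any (lose e∈S leaf)) within
             ∣ X - x₀ ∣ 1 (X - x₀) (here refl) ℕ.≤-refl
             (Subset.x∈p⇒∣p-x∣<∣p∣ (within (here refl) zero)) visited₀
    m<∣X∣ = proj₁ (proj₂ walk)
    closed = proj₂ (proj₂ walk)
  ... | yes any with find any
  ... | e , e∈S , j , k , j≢k , ¬sⱼ , ¬sₖ = begin-strict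
    2 * length S         ≤⟨ ℕ.*-monoʳ-≤ 2 (length-filter-≢ _≟E_ e u) ⟩
    2 * suc (length S')  ≡⟨ ℕ.*-suc 2 (length S') ⟩
    2 + 2 * length S'    <⟨ ℕ.+-monoʳ-< 2 rec ⟩
    2 + ∣ X' ∣           ≤⟨ s≤s (Subset.x∈p⇒∣p-x∣<∣p∣ k∈X-j) ⟩
    1 + ∣ X - point e j ∣ ≤⟨ Subset.x∈p⇒∣p-x∣<∣p∣ (within e∈S j) ⟩
    ∣ X ∣                ∎
    where
    open ≤-Reasoning
    P? = λ e' → ¬? (e' ≟E e)
    S' = filter P? S
    X' = X - point e j - point e k

    keeps : ∀ {y} → y Subset.∈ X → y ≢ point e j → y ≢ point e k → y Subset.∈ X'
    keeps y∈X y≢j y≢k = Subset.x∈p∧x≢y⇒x∈p-y (Subset.x∈p∧x≢y⇒x∈p-y y∈X y≢j) y≢k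

    k∈X-j : point e k Subset.∈ X - point e j
    k∈X-j = Subset.x∈p∧x≢y⇒x∈p-y (within e∈S k) (point-≢ 0<g e (j≢k ∘ sym))

    -- The third point of the peeled edge remains.
    X'-nonempty : Nonempty X'
    X'-nonempty = let t , t≢j , t≢k = third j k in
      point e t , keeps (within e∈S t) (point-≢ 0<g e t≢j) (point-≢ 0<g e t≢k)

    within' : Within X' S'
    within' e'∈S' i = let e'∈S , e'≢e = ∈.∈-filter⁻ P? {xs = S} e'∈S' in
      keeps (within e'∈S i)
        (λ eq → ¬sⱼ (lose e'∈S (e'≢e , i , enc-injective eq)))
        (λ eq → ¬sₖ (lose e'∈S (e'≢e , i , enc-injective eq)))

    ∣S'∣≤n : length S' ≤ n
    ∣S'∣≤n = s≤s⁻¹ (ℕ.<-≤-trans (List.filter-notAll P? S (lose e∈S (λ e≢e → e≢e refl))) ∣S∣≤n)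

    ∣X'∣≤g : ∣ X' ∣ ≤ g
    ∣X'∣≤g = ℕ.≤-trans (ℕ.≤-trans (Subset.∣p─q∣≤∣p∣ (X - point e j) ⁅ point e k ⁆) (Subset.∣p─q∣≤∣p∣ X ⁅ point e j ⁆)) ∣X∣≤g

    rec : 2 * length S' < ∣ X' ∣
    rec = sparse 0<g n S' X' ∣S'∣≤n (Unique.filter⁺ P? u) within' X'-nonempty ∣X'∣≤g

  -- Edges as three-element sets

  -- The union ends in `Subset.⊥` so that `∣⁅⁆∪p∩q∣` splits off each of the three points in the same
  -- way.
  edge : E → Subset nv
  edge e = ⁅ point e zero ⁆ ∪ (⁅ point e (suc zero) ⁆ ∪ (⁅ point e (suc (suc zero)) ⁆ ∪ Subset.⊥))

  point∈edge : ∀ e j → point e j Subset.∈ edge e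
  point∈edge e zero             = Subset.x∈p∪q⁺ (inj₁ (Subset.x∈⁅x⁆ _))
  point∈edge e (suc zero)       = Subset.x∈p∪q⁺ (inj₂ (Subset.x∈p∪q⁺ (inj₁ (Subset.x∈⁅x⁆ _))))
  point∈edge e (suc (suc zero)) =
    Subset.x∈p∪q⁺ (inj₂ (Subset.x∈p∪q⁺ (inj₂ (Subset.x∈p∪q⁺ (inj₁ (Subset.x∈⁅x⁆ _))))))

  ∈edge⇒point : ∀ {x} e → x Subset.∈ edge e → ∃ λ j → x ≡ point e j
  ∈edge⇒point e x∈ with Subset.x∈p∪q⁻ _ _ x∈
  ... | inj₁ x∈₀ = _ , Subset.x∈⁅y⁆⇒x≡y _ x∈₀
  ... | inj₂ x∈' with Subset.x∈p∪q⁻ _ _ x∈'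
  ... | inj₁ x∈₁ = _ , Subset.x∈⁅y⁆⇒x≡y _ x∈₁
  ... | inj₂ x∈'' with Subset.x∈p∪q⁻ _ _ x∈''
  ... | inj₁ x∈₂ = _ , Subset.x∈⁅y⁆⇒x≡y _ x∈₂
  ... | inj₂ x∈⊥ = contradiction x∈⊥ Subset.∉⊥

  -- Distinct edges on the same points share two vertices and so form a closed walk of two steps.
  edge-injective : 1 < g → ∀ {e e'} → edge e ≡ edge e' → e ≡ e'
  edge-injective 1<g {e} {e'} eq with e ≟E e'
  ... | yes e≡e' = e≡e'
  ... | no  e≢e' = contradiction
      (e , zero , suc zero , (λ ()) ,
       step e' j₁ j₀ (enc-injective eq₁) (e≢e' ∘ ,-injectiveˡ) j₁≢j₀ (stop (enc-injective (sym eq₀))))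
      (girth 1<g)
    where
    meet : ∀ i → ∃ λ j → point e i ≡ point e' j
    meet i = ∈edge⇒point e' (subst (point e i Subset.∈_) eq (point∈edge e i))
    j₀  = proj₁ (meet zero)
    eq₀ = proj₂ (meet zero)
    j₁  = proj₁ (meet (suc zero))
    eq₁ = proj₂ (meet (suc zero))
    j₁≢j₀ : j₁ ≢ j₀
    j₁≢j₀ j₁≡j₀ with () ← inc-injective (ℕ.<-trans (s≤s z≤n) 1<g) e {zero} {suc zero}
      (enc-injective (trans eq₀ (trans (cong (point e') (sym j₁≡j₀)) (sym eq₁))))

  -- Used twice: the full set gives the size of an edge, and reduction modulo 2 gives `sum₃` of the
  -- indicator of `X`.
  ∣edge∩∣ : 0 < g → ∀ e X → ∣ edge e ∩ X ∣ ≡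
    bit (lookup X (point e zero)) + (bit (lookup X (point e (suc zero))) +
      (bit (lookup X (point e (suc (suc zero)))) + 0))
  ∣edge∩∣ 0<g e X =
    trans (∣⁅⁆∪p∩q∣ _ _ X a∉) (cong (bit (lookup X (point e zero)) +_)
    (trans (∣⁅⁆∪p∩q∣ _ _ X b∉) (cong (bit (lookup X (point e (suc zero))) +_)
    (trans (∣⁅⁆∪p∩q∣ _ _ X Subset.∉⊥) (cong (bit (lookup X (point e (suc (suc zero)))) +_)
    (trans (cong ∣_∣ (Subset.∩-zeroˡ X)) (Subset.∣⊥∣≡0 nv)))))))
    where
    b∉ : point e (suc zero) Subset.∉ ⁅ point e (suc (suc zero)) ⁆ ∪ Subset.⊥
    b∉ b∈ with Subset.x∈p∪q⁻ _ _ b∈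
    ... | inj₁ b∈c = point-≢ 0<g e (λ ()) (Subset.x∈⁅y⁆⇒x≡y _ b∈c)
    ... | inj₂ b∈⊥ = Subset.∉⊥ b∈⊥
    a∉ : point e zero Subset.∉ ⁅ point e (suc zero) ⁆ ∪ (⁅ point e (suc (suc zero)) ⁆ ∪ Subset.⊥)
    a∉ a∈ with Subset.x∈p∪q⁻ _ _ a∈
    ... | inj₁ a∈b = point-≢ 0<g e (λ ()) (Subset.x∈⁅y⁆⇒x≡y _ a∈b)
    ... | inj₂ a∈' with Subset.x∈p∪q⁻ _ _ a∈'
    ... | inj₁ a∈c = point-≢ 0<g e (λ ()) (Subset.x∈⁅y⁆⇒x≡y _ a∈c)
    ... | inj₂ a∈⊥ = Subset.∉⊥ a∈⊥

  ∣edge∣≡3 : 0 < g → ∀ e → ∣ edge e ∣ ≡ 3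
  ∣edge∣≡3 0<g e
    rewrite sym (Subset.∩-identityʳ (edge e)) | ∣edge∩∣ 0<g e Subset.⊤
          | Vec.lookup-replicate (point e zero) inside
          | Vec.lookup-replicate (point e (suc zero)) inside
          | Vec.lookup-replicate (point e (suc (suc zero))) inside = refl

  -- The hypergraph, odd and meager

  allEdges : List E
  allEdges = map (Inverse.from E↔) (allFin ne)

  allEdges-unique : Unique allEdges
  allEdges-unique = Unique.map⁺ (Injection.injective (↔⇒↣ (↔-sym E↔))) (Unique.allFin⁺ ne)

  ∈allEdges : ∀ e → e ∈ allEdges
  ∈allEdges e = subst (_∈ allEdges) (Inverse.strictlyInverseʳ E↔ e)
    (∈.∈-map⁺ (Inverse.from E↔) (∈.∈-allFin (Inverse.to E↔ e)))

  hypergraph : 1 < g → Hypergraph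
  hypergraph 1<g = record
    { n        = nv
    ; nonempty = ℕ.≤-<-trans z≤n g<nv
    ; edges    = map edge allEdges
    ; edges-3  = All.map⁺ (All.universal (∣edge∣≡3 (ℕ.<-trans (s≤s z≤n) 1<g)) allEdges)
    ; edges-uq = Unique.map⁺ (edge-injective 1<g) allEdges-unique
    }

  -- If every edge met `X` in an even number of points, the indicator of `X` would lie in the kernel
  -- of the incidence matrix, so `X` would be empty.
  hypergraph-odd : (1<g : 1 < g) → Odd (hypergraph 1<g)
  hypergraph-odd 1<g X (x , x∈X) with Any.any? (λ h → ∣ h ∩ X ∣ % 2 ℕ.≟ 1) (map edge allEdges)
  ... | yes any = any
  ... | no ¬any = contradiction (trans (sym (Vec.[]=⇒lookup x∈X)) x∉X) λ ()
    where
    even : ∀ e → sum₃ (λ j → lookup X (point e j)) ≡ false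
    even e with sum₃ (λ j → lookup X (point e j)) in eq
    ... | false = refl
    ... | true  = contradiction (lose (∈.∈-map⁺ edge (∈allEdges e)) (begin
      ∣ edge e ∩ X ∣ % 2                        ≡⟨ cong (_% 2) (∣edge∩∣ (ℕ.<-trans (s≤s z≤n) 1<g) e X) ⟩
      _                                         ≡⟨ bits-parity (χ zero) (χ (suc zero)) (χ (suc (suc zero))) ⟩
      bit (sum₃ (λ j → lookup X (point e j)))   ≡⟨ cong bit eq ⟩
      1                                         ∎)) ¬any
      where
      open ≡-Reasoning
      χ = λ j → lookup X (point e j)

    x∉X : lookup X x ≡ false
    x∉X = trans (cong (lookup X) (sym (Inverse.strictlyInverseˡ V↔ x)))
                (odd (lookup X ∘ enc) even (Inverse.from V↔ x))

  hypergraph-sparse : (1<g : 1 < g) → ∀ X → Nonempty X → ∣ X ∣ ≤ g → ¬ Dense (hypergraph 1<g) X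
  hypergraph-sparse 1<g X X-nonempty ∣X∣≤g dense = ℕ.<⇒≱ few dense
    where
    inX? = λ e → edge e Subset.⊆? X
    S = filter inX? allEdges

    few : 2 * weight (hypergraph 1<g) X < ∣ X ∣
    few = subst (λ w → 2 * w < ∣ X ∣) (sym (length-filter-map (Subset._⊆? X) edge allEdges))
      (sparse (ℕ.<-trans (s≤s z≤n) 1<g) (length S) S X ℕ.≤-refl (Unique.filter⁺ inX? allEdges-unique)
        (λ {e} e∈S j → proj₂ (∈.∈-filter⁻ inX? {xs = allEdges} e∈S) (point∈edge e j)) X-nonempty ∣X∣≤g)

theorem3p1 : (l N : ℕ) → 2 ≤ l → 0 < N → Σ Hypergraph (λ H → Odd H × Meager l H × N < numVertices H)
theorem3p1 l N 2≤l 0<N =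
  hypergraph 1<g , hypergraph-odd 1<g ,
  (λ X ne ∣X∣≤2l → hypergraph-sparse 1<g X ne (ℕ.≤-trans ∣X∣≤2l (ℕ.m≤m+n (2 * l) N))) ,
  ℕ.≤-<-trans (ℕ.m≤n+m N (2 * l)) (OddGirth.g<nv H)
  where
  -- The summand `2 * l` serves meagerness and `N` the number of vertices, which exceeds the girth
  -- bound.
  H = oddGirth (2 * l + N)
  open Realisation H
  1<g : 1 < 2 * l + N
  1<g = ℕ.≤-trans 2≤l (ℕ.≤-trans (ℕ.m≤m+n l (1 * l)) (ℕ.m≤m+n (2 * l) N))
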